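{- Define integers $a_{r,j}$ and $b_{r,j}$ for $r\geqslant 1$, $j\geqslant 0$ by the initial conditions $$a_{1,j}=b_{1,j}=\begin{cases}1,& j=0,\\ 0,& j>0,\end{cases}$$ and, for all $r\geqslant 1$ and $j\geqslant 0$, the recurrence relations $$a_{r+1,j} = a_{r,j+1} - \mu(r)\, b_{r,j+1}-\begin{cases}0,& j+1<r,\\ a_{r,j+1-r},& j+1\geqslant r,\end{cases}$$ $$b_{r+1,j} = b_{r,j}-\begin{cases}0,& j<r,\\ b_{r,j-r},& j\geqslant r.\end{cases}$$ Then for all integers $n\geqslant 0$ and $r\geqslant 1$, $$\sum_{k=r}^{n+r} S^{(r)}_{n+r,k}\, \mu(k) = \sum_{j\geqslant 0} a_{r,j}\, p(n-j).$$
   Context: $p(m)$ denotes the number of partitions of the integer $m$, with $p(0)=1$ and $p(m)=0$ for $m<0$ (so the sum over $j$ is finite). $\mu$ is the classical Möbius function on positive integers: $\mu(m)=0$ if $m$ is divisible by the square of a prime, and $\mu(m)=(-1)^s$ if $m$ is a product of $s\geqslant 0$ distinct primes. For integers $r\geqslant 1$, $k\geqslant 1$, $m\geqslant 0$, $S^{(r)}_{m,k}$ denotes the number of $k$'s in the partitions of $m$ with smallest part at least $r$, i.e. the total number of occurrences (with multiplicity) of the part $k$ summed over all partitions of $m$ all of whose parts are $\geqslant r$. -}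

module Defs where

open import Algebra.Bundles using (CommutativeRing)
open import Data.Bool.Base using (if_then_else_)
open import Data.Fin.Base using (toℕ)
open import Data.Integer.Base as ℤ using (ℤ; 0ℤ; 1ℤ; -1ℤ; +_; -[1+_])
import Data.Integer.Properties as ℤ
open import Data.List.Base using (List; []; _∷_; length; map; filter; upTo; cartesianProductWith)
open import Data.List.Membership.Propositional using (_∈_)
open import Data.List.Membership.Propositional.Properties
  using (∈-filter⁺; ∈-filter⁻; ∈-map⁺; ∈-map⁻; ∈-upTo⁺; ∈-cartesianProductWith⁺; ∈-cartesianProductWith⁻)
open import Data.List.Properties using (∷-injective)
open import Data.List.Relation.Unary.All as All using (All; []; _∷_; all?)
open import Data.List.Relation.Unary.AllPairs using ([]; _∷_)
open import Data.List.Relation.Unary.Any using (here; there)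
open import Data.List.Relation.Unary.Unique.Propositional using (Unique)
import Data.List.Relation.Unary.Unique.Propositional.Properties as Unique
open import Data.Nat.Base using (ℕ; zero; suc; _+_; _*_; _∸_; _≤_; s≤s; NonZero)
open import Data.Nat.Divisibility using (_∣_; _∣?_; ∣⇒≤)
open import Data.Nat.ListAction using (sum)
open import Data.Nat.Primality using (Prime; prime?; prime⇒nonZero)
open import Data.Nat.Primality.Factorisation using (factors; factorise)
open import Data.Nat.Properties
open import Data.Product.Base using (∃; _×_; _,_; proj₂)
open import Function.Base using (_∘_)
open import Relation.Binary.PropositionalEquality using (_≡_; _≢_; refl)
open import Relation.Nullary.Decidable using (Dec; does; map′; _×-dec_)
open import Relation.Unary using (Decidable)

open import Algebra.Properties.Semiring.Sum (CommutativeRing.semiring ℤ.+-*-commutativeRing)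
  using (sum-syntax)
open import Data.List.Relation.Unary.Sorted.TotalOrder ≤-totalOrder using (Sorted; sorted?)

∑-interval : ℕ → ℕ → (ℕ → ℤ) → ℤ
∑-interval lo hi f = ∑[ i < suc hi ∸ lo ] f (lo + toℕ i)

syntax ∑-interval lo hi (λ k → x) = ∑[ k from lo to hi ] x

-- The sum of f over all j ≥ 0 has only finitely many nonzero terms and
-- its value is s.
infix 4 ∑≥0-syntax

∑≥0-syntax : (ℕ → ℤ) → ℤ → Set
∑≥0-syntax f s = ∃ λ N → (∀ j → N ≤ j → f j ≡ 0ℤ) × (∑[ j < N ] f (toℕ j)) ≡ s

syntax ∑≥0-syntax (λ j → x) s = s ≡∑[ j ≥0] x

PrimeSquareDivides : ℕ → Set
PrimeSquareDivides m = ∃ λ p → Prime p × p * p ∣ m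

primeSquareDivides? : ∀ m → .{{NonZero m}} → Dec (PrimeSquareDivides m)
primeSquareDivides? m =
  map′ (λ (p , _ , h) → p , h)
       (λ (p , pr , p²∣m) → p , s≤s (bound p pr p²∣m) , pr , p²∣m)
       (anyUpTo? (λ p → prime? p ×-dec p * p ∣? m) (suc m))
  where
  bound : ∀ p → Prime p → p * p ∣ m → p ≤ m
  bound p pr p²∣m = ≤-trans (m≤m*n p p {{prime⇒nonZero pr}}) (∣⇒≤ p²∣m)

-- In the second branch m is squarefree, so its prime factors are distinct.
-- The value at 0 is a convention that is never used.
μ : ℕ → ℤ
μ zero      = 0ℤ
μ m@(suc _) =
  if does (primeSquareDivides? m)
  then 0ℤ
  else -1ℤ ℤ.^ length (factors (factorise m))

-- A partition is represented by its parts listed in weakly increasing order.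
IsPartition : ℕ → List ℕ → Set
IsPartition m xs = All (1 ≤_) xs × Sorted xs × sum xs ≡ m

isPartition? : ∀ m → Decidable (IsPartition m)
isPartition? m xs = all? (1 ≤?_) xs ×-dec sorted? _≤?_ xs ×-dec sum xs ≟ m

-- All lists of length at most l with entries in {1, …, m}.
boundedLists : ℕ → ℕ → List (List ℕ)
boundedLists m zero    = [] ∷ []
boundedLists m (suc l) = [] ∷ cartesianProductWith _∷_ (map suc (upTo m)) (boundedLists m l)

partitions : ℕ → List (List ℕ)
partitions m = filter (isPartition? m) (boundedLists m m)

p : ℤ → ℕ
p (+ m)      = length (partitions m)
p (-[1+ _ ]) = 0

occurrences : ℕ → List ℕ → ℕ
occurrences k xs = length (filter (k ≟_) xs)

-- S r m k is the number of k's in the partitions of m with smallest part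
-- at least r.
S : ℕ → ℕ → ℕ → ℕ
S r m k = sum (map (occurrences k) (filter (all? (r ≤?_)) (partitions m)))

-- partitions m lists every partition of m exactly once.

∈-partitions⁻ : ∀ {m xs} → xs ∈ partitions m → IsPartition m xs
∈-partitions⁻ {m} = proj₂ ∘ ∈-filter⁻ (isPartition? m) {xs = boundedLists m m}

∈-boundedLists⁺ : ∀ {m} l {xs} → All (1 ≤_) xs → sum xs ≤ m → sum xs ≤ l →
                  xs ∈ boundedLists m l
∈-boundedLists⁺ zero    []        _    _    = here refl
∈-boundedLists⁺ (suc l) []        _    _    = here refl
∈-boundedLists⁺ zero    (s≤s _ ∷ _) _ ()
∈-boundedLists⁺ (suc l) (_∷_ {suc x} {xs} _ 1≤xs) ≤m (s≤s ≤l) =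
  there (∈-cartesianProductWith⁺ _∷_
    (∈-map⁺ suc (∈-upTo⁺ (≤-trans (m≤m+n (suc x) (sum xs)) ≤m)))
    (∈-boundedLists⁺ l 1≤xs (≤-trans (m≤n+m (sum xs) (suc x)) ≤m)
                            (≤-trans (m≤n+m (sum xs) x) ≤l)))

∈-partitions⁺ : ∀ {m xs} → IsPartition m xs → xs ∈ partitions m
∈-partitions⁺ {m} part@(1≤xs , _ , refl) =
  ∈-filter⁺ (isPartition? m) (∈-boundedLists⁺ m 1≤xs ≤-refl ≤-refl) part

boundedLists-unique : ∀ m l → Unique (boundedLists m l)
boundedLists-unique m zero    = [] ∷ []
boundedLists-unique m (suc l) =
  All.tabulate []≢ ∷
  Unique.cartesianProductWith⁺ _∷_ ∷-injective
    (Unique.map⁺ suc-injective (Unique.upTo⁺ m)) (boundedLists-unique m l)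
  where
  []≢ : ∀ {ys} → ys ∈ cartesianProductWith _∷_ (map suc (upTo m)) (boundedLists m l) →
        [] ≢ ys
  []≢ ys∈ refl with () ← proj₂ (proj₂ (proj₂ (proj₂
    (∈-cartesianProductWith⁻ _∷_ (map suc (upTo m)) (boundedLists m l) ys∈))))

partitions-unique : ∀ m → Unique (partitions m)
partitions-unique m = Unique.filter⁺ (isPartition? m) (boundedLists-unique m m)

-- The rows r = 0 are a convention that is never used.

b : ℕ → ℕ → ℤ
b 0             _       = 0ℤ
b 1             zero    = 1ℤ
b 1             (suc _) = 0ℤ
b (suc r@(suc _)) j     =
  b r j ℤ.- (if does (j <? r) then 0ℤ else b r (j ∸ r))

a : ℕ → ℕ → ℤ
a 0             _       = 0ℤ
a 1             zero    = 1ℤ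
a 1             (suc _) = 0ℤ
a (suc r@(suc _)) j     =
  a r (suc j) ℤ.- μ r ℤ.* b r (suc j)
              ℤ.- (if does (suc j <? r) then 0ℤ else a r (suc j ∸ r))

module Submission where

-- Count by generating functions, q^r acting as shift r and products being conv.  Write
-- C_r for the sequence counting partitions with parts ≥ r, S_k^r for the number of k's
-- in them, and T_r for Σ_k μ(k) S_k^r.  Removing one part r from a partition whose
-- smallest part is r gives
--   C_r = C_{r+1} + q^r C_r   and   T_r = T_{r+1} + q^r (T_r + μ(r) C_r),
-- while removing one part k gives S_k^r = q^k (C_r + S_k^r).  For r = 1 the latter
-- says S_k^1 = Σ_{k ∣ d} q^d P, so Möbius inversion yields T_1 = q P.  By induction
-- C_r = b_r P and T_r = q^r a_r P; in the step, T_{r+1} is q^r times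
-- (a_r − μ(r) b_r − q^r a_r) P, whose constant term is 0 because T_{r+1} has no
-- term of degree r, so one more factor q splits off and leaves a_{r+1} P.

open import Algebra.Bundles using (CommutativeRing)
open import Data.Bool.Base using (if_then_else_)
open import Data.Empty using (⊥-elim)
open import Data.Fin.Base using (toℕ)
open import Data.Fin.Properties using (toℕ<n)
open import Data.Integer.Base as ℤ using (ℤ; 0ℤ; 1ℤ; -1ℤ; +_)
import Data.Integer.Properties as ℤ
open import Data.Integer.Tactic.RingSolver using (solve-∀)
open import Data.List.Base using (List; []; _∷_; _++_; length; map; filter)
open import Data.List.Membership.Propositional using (_∈_)
open import Data.List.Membership.Propositional.Properties
  using (∈-filter⁺; ∈-filter⁻; ∈-map⁺; ∈-map⁻; ∈-++⁺ˡ; ∈-++⁺ʳ; ∈-++⁻)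
open import Data.List.Membership.Propositional.Properties.WithK using (unique∧set⇒bag)
open import Data.List.Properties
  using (map-++; map-∘; map-cong; filter-accept; filter-reject; filter-all; ∷-injectiveʳ)
open import Data.List.Relation.Binary.BagAndSetEquality using (∼bag⇒↭)
open import Data.List.Relation.Binary.Disjoint.Propositional using (Disjoint)
open import Data.List.Relation.Binary.Permutation.Propositional using (_↭_)
open import Data.List.Relation.Binary.Permutation.Propositional.Properties using (map⁺; ↭-length)
open import Data.List.Relation.Unary.All as All using (All; []; _∷_; all?)
open import Data.List.Relation.Unary.AllPairs using (_∷_)
open import Data.List.Relation.Unary.Any using (here; there)
import Data.List.Relation.Unary.Linked as Linked
open import Data.List.Relation.Unary.Sorted.TotalOrder.Properties using (AllPairs⇒Sorted; Sorted⇒AllPairs)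
open import Data.List.Relation.Unary.Unique.Propositional using (Unique)
import Data.List.Relation.Unary.Unique.Propositional.Properties as Unique
open import Data.Nat.Base
  using (ℕ; zero; suc; _+_; _*_; _∸_; _≤_; _<_; z≤n; s≤s; NonZero; ≢-nonZero)
open import Data.Nat.Divisibility
open import Data.Nat.Induction using (<-rec)
open import Data.Nat.ListAction using (sum; product)
open import Data.Nat.ListAction.Properties using (sum-++; sum-↭)
open import Data.Nat.Primality using (Prime; prime⇒nonZero; prime⇒irreducible; euclidsLemma; ¬prime[1])
open import Data.Nat.Primality.Factorisation using (PrimeFactorisation; factorise; factorisationUnique)
open import Data.Nat.Properties
open import Data.Product.Base using (∃; _×_; _,_; proj₁)
open import Data.Sum.Base using (_⊎_; inj₁; inj₂; [_,_]′)
open import Function.Base using (_∘_; const)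
open import Function.Bundles using (mk⇔)
open import Relation.Binary.PropositionalEquality
open import Relation.Nullary.Decidable using (Dec; yes; no; does; dec-true; dec-false)
open import Relation.Nullary.Negation using (¬_)
open import Defs

open import Algebra.Properties.CommutativeSemigroup +-commutativeSemigroup using (interchange)
open import Algebra.Properties.Semiring.Sum (CommutativeRing.semiring ℤ.+-*-commutativeRing)
  using (sum-syntax; sum-cong-≗; ∑-distrib-+; ∑-comm; *-distribˡ-sum; *-distribʳ-sum)
open import Data.List.Relation.Unary.Sorted.TotalOrder ≤-totalOrder using (Sorted)

open PrimeFactorisation
open ≡-Reasoning

-- Sequences and convolution

Seq : Set
Seq = ℕ → ℤ

∑< : ℕ → Seq → ℤ
∑< n f = ∑[ i < n ] f (toℕ i)

∑<-cong : ∀ n {f g : Seq} → (∀ i → i < n → f i ≡ g i) → ∑< n f ≡ ∑< n g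
∑<-cong n eq = sum-cong-≗ λ i → eq (toℕ i) (toℕ<n i)

∑<-zero : ∀ n {f : Seq} → (∀ i → i < n → f i ≡ 0ℤ) → ∑< n f ≡ 0ℤ
∑<-zero zero    eq = refl
∑<-zero (suc n) eq = cong₂ ℤ._+_ (eq 0 (s≤s z≤n)) (∑<-zero n λ i i<n → eq (suc i) (s≤s i<n))

∑<-distrib-+ : ∀ n (f g : Seq) → ∑< n (λ i → f i ℤ.+ g i) ≡ ∑< n f ℤ.+ ∑< n g
∑<-distrib-+ n f g = ∑-distrib-+ {n} (λ i → f (toℕ i)) λ i → g (toℕ i)

∑<-minus : ∀ n (f g : Seq) → ∑< n (λ i → f i ℤ.- g i) ≡ ∑< n f ℤ.- ∑< n g
∑<-minus zero    f g = refl
∑<-minus (suc n) f g =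
  trans (cong (ℤ._+_ (f 0 ℤ.- g 0)) (∑<-minus n (f ∘ suc) (g ∘ suc))) (rearrange (f 0) (g 0) (∑< n (f ∘ suc)) (∑< n (g ∘ suc)))
  where
  rearrange : ∀ w x y z → (w ℤ.- x) ℤ.+ (y ℤ.- z) ≡ (w ℤ.+ y) ℤ.- (x ℤ.+ z)
  rearrange = solve-∀

∑<-drop : ∀ r n (f : Seq) → (∀ i → i < r → f i ≡ 0ℤ) → ∑< (r + n) f ≡ ∑< n (λ i → f (r + i))
∑<-drop zero    n f eq = refl
∑<-drop (suc r) n f eq =
  trans (cong (ℤ._+ ∑< (r + n) (f ∘ suc)) (eq 0 (s≤s z≤n)))
  (trans (ℤ.+-identityˡ _) (∑<-drop r n (f ∘ suc) λ i i<r → eq (suc i) (s≤s i<r)))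

∑<-single : ∀ n (f : Seq) {c} → c < n → (∀ i → i ≢ c → f i ≡ 0ℤ) → ∑< n f ≡ f c
∑<-single (suc n) f {zero} _ eq =
  trans (cong (ℤ._+_ (f 0)) (∑<-zero n λ i _ → eq (suc i) λ ())) (ℤ.+-identityʳ _)
∑<-single (suc n) f {suc c} (s≤s c<n) eq =
  trans (cong₂ ℤ._+_ (eq 0 λ ()) (∑<-single n (f ∘ suc) c<n λ i i≢c → eq (suc i) (i≢c ∘ suc-injective)))
        (ℤ.+-identityˡ _)

-- Recursion on `r` and on the index, rather than a test `m < r`, makes the laws below plain
-- inductions; `shift-if` recovers the conditional in the recurrences of `a` and `b`.
shift : ℕ → Seq → Seq
shift zero    f m       = f m
shift (suc r) f zero    = 0ℤ
shift (suc r) f (suc m) = shift r f m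

shift-if : ∀ r f m → (if does (m <? r) then 0ℤ else f (m ∸ r)) ≡ shift r f m
shift-if zero    f m       = refl
shift-if (suc r) f zero    = refl
shift-if (suc r) f (suc m) = shift-if r f m

shift-< : ∀ r f m → m < r → shift r f m ≡ 0ℤ
shift-< (suc r) f zero    _         = refl
shift-< (suc r) f (suc m) (s≤s m<r) = shift-< r f m m<r

shift-+ : ∀ r f m → shift r f (r + m) ≡ f m
shift-+ zero    f m = refl
shift-+ (suc r) f m = shift-+ r f m

-- Degree `m` of the shifted sequence reads only the index `i` with `r + i ≡ m`. This weak
-- hypothesis admits strong induction on `m` and identities known only below a bound.
shift-cong : ∀ r {f g : Seq} m → (∀ i → r + i ≡ m → f i ≡ g i) → shift r f m ≡ shift r g m
shift-cong zero    m       eq = eq m refl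
shift-cong (suc r) zero    eq = refl
shift-cong (suc r) (suc m) eq = shift-cong r m λ i r+i≡m → eq i (cong suc r+i≡m)

shift-≗ : ∀ r {f g : Seq} → f ≗ g → shift r f ≗ shift r g
shift-≗ r eq m = shift-cong r m λ i _ → eq i

-- The pointwise operations commuting with shifts are those preserving 0.
shift-map₂ : ∀ (_∙_ : ℤ → ℤ → ℤ) → 0ℤ ∙ 0ℤ ≡ 0ℤ → ∀ r f g m →
             shift r (λ i → f i ∙ g i) m ≡ shift r f m ∙ shift r g m
shift-map₂ _∙_ eq zero    f g m       = refl
shift-map₂ _∙_ eq (suc r) f g zero    = sym eq
shift-map₂ _∙_ eq (suc r) f g (suc m) = shift-map₂ _∙_ eq r f g m

shift-distrib-+ : ∀ r f g m → shift r (λ i → f i ℤ.+ g i) m ≡ shift r f m ℤ.+ shift r g m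
shift-distrib-+ = shift-map₂ ℤ._+_ refl

shift-distrib-minus : ∀ r f g m → shift r (λ i → f i ℤ.- g i) m ≡ shift r f m ℤ.- shift r g m
shift-distrib-minus = shift-map₂ ℤ._-_ refl

shift-*ˡ : ∀ x r f m → shift r (λ i → x ℤ.* f i) m ≡ x ℤ.* shift r f m
shift-*ˡ x r f = shift-map₂ (λ y _ → x ℤ.* y) (ℤ.*-zeroʳ x) r f f

shift-∑< : ∀ n r (f : ℕ → Seq) m →
           shift r (λ i → ∑< n (λ k → f k i)) m ≡ ∑< n (λ k → shift r (f k) m)
shift-∑< n zero    f m       = refl
shift-∑< n (suc r) f zero    = sym (∑<-zero n λ _ _ → refl)
shift-∑< n (suc r) f (suc m) = shift-∑< n r f m

shift-shift : ∀ r s f m → shift r (shift s f) m ≡ shift (r + s) f m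
shift-shift zero    s f m       = refl
shift-shift (suc r) s f zero    = refl
shift-shift (suc r) s f (suc m) = shift-shift r s f m

shift-comm : ∀ r s f m → shift r (shift s f) m ≡ shift s (shift r f) m
shift-comm r s f m = begin
  shift r (shift s f) m ≡⟨ shift-shift r s f m ⟩
  shift (r + s) f m     ≡⟨ cong (λ t → shift t f m) (+-comm r s) ⟩
  shift (s + r) f m     ≡⟨ shift-shift s r f m ⟨
  shift s (shift r f) m ∎

-- Both sequences solve (1 - q^r) F = h, and 1 - q^r is invertible because `1 ≤ r`: the shift looks
-- only at smaller indices, so strong induction applies.
shift-recurrence-unique : ∀ {r} {h f g : Seq} → 1 ≤ r →
  (∀ m → f m ≡ h m ℤ.+ shift r f m) → (∀ m → g m ≡ h m ℤ.+ shift r g m) → f ≗ g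
shift-recurrence-unique {suc r} {h} {f} {g} _ f-rec g-rec = <-rec (λ m → f m ≡ g m) λ m rec → begin
  f m                         ≡⟨ f-rec m ⟩
  h m ℤ.+ shift (suc r) f m   ≡⟨ cong (ℤ._+_ (h m)) (shift-cong (suc r) m λ { i refl → rec (s≤s (m≤n+m i r)) }) ⟩
  h m ℤ.+ shift (suc r) g m   ≡⟨ g-rec m ⟨
  g m                         ∎

conv : Seq → Seq → Seq
conv f g n = ∑< (suc n) (λ j → f j ℤ.* g (n ∸ j))

-- Degree `n` of a product sees only the coefficients up to `n`; this serves for Möbius sums
-- truncated at `N`, which are correct only below `N`.
conv-congˡ-≤ : ∀ {f g} h n → (∀ j → j ≤ n → f j ≡ g j) → conv f h n ≡ conv g h n
conv-congˡ-≤ h n eq = ∑<-cong (suc n) λ { j (s≤s j≤n) → cong (ℤ._* h (n ∸ j)) (eq j j≤n) }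

conv-congˡ : ∀ {f g} h → f ≗ g → conv f h ≗ conv g h
conv-congˡ h eq n = conv-congˡ-≤ h n λ j _ → eq j

conv-distrib-+ : ∀ f g h n → conv (λ j → f j ℤ.+ g j) h n ≡ conv f h n ℤ.+ conv g h n
conv-distrib-+ f g h n = trans
  (∑<-cong (suc n) λ j _ → ℤ.*-distribʳ-+ (h (n ∸ j)) (f j) (g j))
  (∑<-distrib-+ (suc n) (λ j → f j ℤ.* h (n ∸ j)) λ j → g j ℤ.* h (n ∸ j))

conv-distrib-minus : ∀ f g h n → conv (λ j → f j ℤ.- g j) h n ≡ conv f h n ℤ.- conv g h n
conv-distrib-minus f g h n = trans
  (∑<-cong (suc n) λ j _ → distrib (f j) (g j) (h (n ∸ j)))
  (∑<-minus (suc n) (λ j → f j ℤ.* h (n ∸ j)) λ j → g j ℤ.* h (n ∸ j))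
  where
  distrib : ∀ x y z → (x ℤ.- y) ℤ.* z ≡ x ℤ.* z ℤ.- y ℤ.* z
  distrib = solve-∀

conv-*ˡ : ∀ x f h n → conv (λ j → x ℤ.* f j) h n ≡ x ℤ.* conv f h n
conv-*ˡ x f h n = trans
  (∑<-cong (suc n) λ j _ → ℤ.*-assoc x (f j) (h (n ∸ j)))
  (sym (*-distribˡ-sum {suc n} x λ i → f (toℕ i) ℤ.* h (n ∸ toℕ i)))

conv-∑< : ∀ N (f : ℕ → Seq) h n → conv (λ j → ∑< N (λ k → f k j)) h n ≡ ∑< N (λ k → conv (f k) h n)
conv-∑< N f h n = trans
  (∑<-cong (suc n) λ j _ → *-distribʳ-sum {N} (h (n ∸ j)) λ k → f (toℕ k) j)
  (∑-comm {suc n} {N} λ j k → f (toℕ k) (toℕ j) ℤ.* h (n ∸ toℕ j))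

conv-shift : ∀ r f h n → conv (shift r f) h n ≡ shift r (conv f h) n
conv-shift zero    f h n       = refl
conv-shift (suc r) f h zero    = refl
conv-shift (suc r) f h (suc n) = trans (ℤ.+-identityˡ _) (conv-shift r f h n)

δ : Seq
δ zero    = 1ℤ
δ (suc _) = 0ℤ

conv-identityˡ : ∀ h n → conv δ h n ≡ h n
conv-identityˡ h n = begin
  1ℤ ℤ.* h n ℤ.+ ∑< n (λ _ → 0ℤ) ≡⟨ cong₂ ℤ._+_ (ℤ.*-identityˡ (h n)) (∑<-zero n λ _ _ → refl) ⟩
  h n ℤ.+ 0ℤ            ≡⟨ ℤ.+-identityʳ (h n) ⟩
  h n                   ∎

-- Partitions with bounded smallest part

-- Partitions are enumerated by filtering, in no convenient order. Duplicate-free lists can be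
-- compared by membership alone, and sums are invariant under permutation.
unique∧set⇒↭ : ∀ {A : Set} {xs ys : List A} → Unique xs → Unique ys →
               (∀ {x} → x ∈ xs → x ∈ ys) → (∀ {x} → x ∈ ys → x ∈ xs) → xs ↭ ys
unique∧set⇒↭ xs! ys! to from = ∼bag⇒↭ (unique∧set⇒bag xs! ys! (mk⇔ to from))

IsPartition≥ : ℕ → ℕ → List ℕ → Set
IsPartition≥ r m xs = All (r ≤_) xs × Sorted xs × sum xs ≡ m

partitions≥ : ℕ → ℕ → List (List ℕ)
partitions≥ r m = filter (all? (r ≤?_)) (partitions m)

partitions≥-unique : ∀ r m → Unique (partitions≥ r m)
partitions≥-unique r m = Unique.filter⁺ (all? (r ≤?_)) (partitions-unique m)

∈-partitions≥⁻ : ∀ r m {xs} → xs ∈ partitions≥ r m → IsPartition≥ r m xs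
∈-partitions≥⁻ r m xs∈ =
  let xs∈′ , r≤xs = ∈-filter⁻ (all? (r ≤?_)) {xs = partitions m} xs∈
      _ , sorted , sum≡ = ∈-partitions⁻ xs∈′
  in r≤xs , sorted , sum≡

∈-partitions≥⁺ : ∀ {r m xs} → 1 ≤ r → IsPartition≥ r m xs → xs ∈ partitions≥ r m
∈-partitions≥⁺ {r} 1≤r (r≤xs , sorted , sum≡) =
  ∈-filter⁺ (all? (r ≤?_)) (∈-partitions⁺ (All.map (≤-trans 1≤r) r≤xs , sorted , sum≡)) r≤xs

weaken : ∀ {r m xs} → IsPartition≥ (suc r) m xs → IsPartition≥ r m xs
weaken (r<xs , sorted , sum≡) = All.map <⇒≤ r<xs , sorted , sum≡

-- By sortedness the head is the smallest part: if it exceeds `r`, so do all parts; otherwise it is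
-- `r` and can be removed.
smallest-part : ∀ {r m xs} → IsPartition≥ r m xs →
  IsPartition≥ (suc r) m xs ⊎ ∃ λ ys → ∃ λ m′ → xs ≡ r ∷ ys × r + m′ ≡ m × IsPartition≥ r m′ ys
smallest-part {xs = []} (_ , sorted , sum≡) = inj₁ ([] , sorted , sum≡)
smallest-part {r} {xs = x ∷ xs} (r≤x ∷ r≤xs , sorted , refl)
  with x≤xs ∷ _ ← Sorted⇒AllPairs ≤-totalOrder sorted | m≤n⇒m<n∨m≡n r≤x
... | inj₁ r<x  = inj₁ (r<x ∷ All.map (≤-trans r<x) x≤xs , sorted , refl)
... | inj₂ refl = inj₂ (xs , sum xs , refl , refl , r≤xs , Linked.tail sorted , refl)

prepend : ∀ {r m xs} → IsPartition≥ r m xs → IsPartition≥ r (r + m) (r ∷ xs)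
prepend {r} (r≤xs , sorted , refl) =
  ≤-refl ∷ r≤xs ,
  AllPairs⇒Sorted ≤-totalOrder (r≤xs ∷ Sorted⇒AllPairs ≤-totalOrder sorted) ,
  refl

-- The second case of `smallest-part` is impossible here, as a part `r` would already exceed the
-- total `m`.
partitions≥-< : ∀ {r m} → 1 ≤ r → m < r → partitions≥ r m ↭ partitions≥ (suc r) m
partitions≥-< {r} {m} 1≤r m<r =
  unique∧set⇒↭ (partitions≥-unique r m) (partitions≥-unique (suc r) m) to
    (∈-partitions≥⁺ 1≤r ∘ weaken ∘ ∈-partitions≥⁻ (suc r) m)
  where
  to : ∀ {xs} → xs ∈ partitions≥ r m → xs ∈ partitions≥ (suc r) m
  to xs∈ with smallest-part (∈-partitions≥⁻ r m xs∈)
  ... | inj₁ part                     = ∈-partitions≥⁺ (s≤s z≤n) part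
  ... | inj₂ (_ , m′ , _ , refl , _) = ⊥-elim (m+n≮m r m′ m<r)

-- These are the two cases of `smallest-part`, with `prepend` undoing the removal; they are disjoint
-- because only lists of the second kind contain `r`.
partitions≥-+ : ∀ {r} m → 1 ≤ r →
  partitions≥ r (r + m) ↭ partitions≥ (suc r) (r + m) ++ map (r ∷_) (partitions≥ r m)
partitions≥-+ {r} m 1≤r =
  unique∧set⇒↭ (partitions≥-unique r (r + m))
    (Unique.++⁺ (partitions≥-unique (suc r) (r + m))
                (Unique.map⁺ ∷-injectiveʳ (partitions≥-unique r m)) disjoint)
    to (λ xs∈ → [ ∈-partitions≥⁺ 1≤r ∘ weaken ∘ ∈-partitions≥⁻ (suc r) (r + m) , fromʳ ]′
                  (∈-++⁻ (partitions≥ (suc r) (r + m)) xs∈))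
  where
  disjoint : Disjoint (partitions≥ (suc r) (r + m)) (map (r ∷_) (partitions≥ r m))
  disjoint (xs∈ , xs∈′) with _ , _ , refl ← ∈-map⁻ (r ∷_) xs∈′
    with r<r ∷ _ , _ ← ∈-partitions≥⁻ (suc r) (r + m) xs∈ = <-irrefl refl r<r

  to : ∀ {xs} → xs ∈ partitions≥ r (r + m) →
       xs ∈ partitions≥ (suc r) (r + m) ++ map (r ∷_) (partitions≥ r m)
  to xs∈ with smallest-part (∈-partitions≥⁻ r (r + m) xs∈)
  ... | inj₁ part = ∈-++⁺ˡ (∈-partitions≥⁺ (s≤s z≤n) part)
  ... | inj₂ (_ , m′ , refl , r+m′≡r+m , part) with refl ← +-cancelˡ-≡ r m′ m r+m′≡r+m =
    ∈-++⁺ʳ (partitions≥ (suc r) (r + m)) (∈-map⁺ (r ∷_) (∈-partitions≥⁺ 1≤r part))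

  fromʳ : ∀ {xs} → xs ∈ map (r ∷_) (partitions≥ r m) → xs ∈ partitions≥ r (r + m)
  fromʳ xs∈ with _ , ys∈ , refl ← ∈-map⁻ (r ∷_) xs∈ =
    ∈-partitions≥⁺ 1≤r (prepend (∈-partitions≥⁻ r m ys∈))

-- Sums of a statistic over partitions

total : (List ℕ → ℕ) → ℕ → Seq
total f r m = + sum (map f (partitions≥ r m))

-- An arbitrary statistic `f` covers both C_r, with `const 1`, and S_k^r, with `occurrences k`.
-- Removing the part `r` turns `f` into `f ∘ (r ∷_)`.
total-recurrence : ∀ f {r} m → 1 ≤ r →
  total f r m ≡ total f (suc r) m ℤ.+ shift r (total (f ∘ (r ∷_)) r) m
total-recurrence f {r} m 1≤r with m <? r
... | yes m<r = begin
  total f r m                                                 ≡⟨ cong +_ (sum-↭ (map⁺ f (partitions≥-< 1≤r m<r))) ⟩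
  total f (suc r) m                                           ≡⟨ ℤ.+-identityʳ _ ⟨
  total f (suc r) m ℤ.+ 0ℤ                                    ≡⟨ cong (ℤ._+_ (total f (suc r) m)) (shift-< r _ m m<r) ⟨
  total f (suc r) m ℤ.+ shift r (total (f ∘ (r ∷_)) r) m      ∎
-- Writing `m` as `r + n` lets the shift evaluate to the total at `n`.
... | no m≮r with n , refl ← m≤n⇒∃[o]m+o≡n (≮⇒≥ m≮r) = cong +_ (begin
  sum (map f (partitions≥ r (r + n)))
    ≡⟨ sum-↭ (map⁺ f (partitions≥-+ n 1≤r)) ⟩
  sum (map f (large ++ map (r ∷_) small))
    ≡⟨ cong sum (map-++ f large (map (r ∷_) small)) ⟩
  sum (map f large ++ map f (map (r ∷_) small))
    ≡⟨ sum-++ (map f large) (map f (map (r ∷_) small)) ⟩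
  sum (map f large) + sum (map f (map (r ∷_) small))
    ≡⟨ cong (λ xs → sum (map f large) + sum xs) (map-∘ small) ⟨
  sum (map f large) + sum (map (f ∘ (r ∷_)) small) ∎)
  ∙ cong (ℤ._+_ (total f (suc r) (r + n))) (sym (shift-+ r (total (f ∘ (r ∷_)) r) n))
  where
  large = partitions≥ (suc r) (r + n)
  small = partitions≥ r n
  _∙_ = trans

sum-map-+ : ∀ {A : Set} (f g : A → ℕ) xs →
            sum (map (λ x → f x + g x) xs) ≡ sum (map f xs) + sum (map g xs)
sum-map-+ f g []       = refl
sum-map-+ f g (x ∷ xs) = begin
  f x + g x + sum (map (λ y → f y + g y) xs)      ≡⟨ cong (_+_ (f x + g x)) (sum-map-+ f g xs) ⟩
  f x + g x + (sum (map f xs) + sum (map g xs))   ≡⟨ interchange (f x) (g x) _ _ ⟩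
  f x + sum (map f xs) + (g x + sum (map g xs))   ∎

sum-map-1 : ∀ {A : Set} (xs : List A) → sum (map (const 1) xs) ≡ length xs
sum-map-1 []       = refl
sum-map-1 (x ∷ xs) = cong suc (sum-map-1 xs)

total-+ : ∀ f g r m → total (λ xs → f xs + g xs) r m ≡ total f r m ℤ.+ total g r m
total-+ f g r m = cong +_ (sum-map-+ f g (partitions≥ r m))

total-zero : ∀ f r m → (∀ xs → IsPartition≥ r m xs → f xs ≡ 0) → total f r m ≡ 0ℤ
total-zero f r m f≡0 = cong +_ (sum-zero (partitions≥ r m) λ xs xs∈ → f≡0 xs (∈-partitions≥⁻ r m xs∈))
  where
  sum-zero : ∀ xss → (∀ xs → xs ∈ xss → f xs ≡ 0) → sum (map f xss) ≡ 0
  sum-zero []         eq = refl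
  sum-zero (xs ∷ xss) eq = cong₂ _+_ (eq xs (here refl)) (sum-zero xss λ ys ys∈ → eq ys (there ys∈))

count : ℕ → Seq
count = total (const 1)

P : Seq
P m = + p (+ m)

count-1 : count 1 ≗ P
count-1 m = cong +_ (begin
  sum (map (const 1) (partitions≥ 1 m)) ≡⟨ sum-map-1 (partitions≥ 1 m) ⟩
  length (partitions≥ 1 m)              ≡⟨ cong length (filter-all (all? (1 ≤?_))
                                                (All.tabulate (proj₁ ∘ ∈-partitions⁻ {m}))) ⟩
  length (partitions m)                 ∎)

count-recurrence : ∀ {r} m → 1 ≤ r → count r m ≡ count (suc r) m ℤ.+ shift r (count r) m
count-recurrence = total-recurrence (const 1)

-- Occurrences of a given part

Sℤ : ℕ → ℕ → Seq
Sℤ k r m = + S r m k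

occurrences-≡ : ∀ k xs → occurrences k (k ∷ xs) ≡ suc (occurrences k xs)
occurrences-≡ k xs = cong length (filter-accept (k ≟_) refl)

occurrences-≢ : ∀ {k x} xs → k ≢ x → occurrences k (x ∷ xs) ≡ occurrences k xs
occurrences-≢ {k} xs k≢x = cong length (filter-reject (k ≟_) k≢x)

occurrences-< : ∀ {k xs} → All (k <_) xs → occurrences k xs ≡ 0
occurrences-< {k} []           = refl
occurrences-< {k} (k<x ∷ k<xs) = trans (occurrences-≢ _ (<⇒≢ k<x)) (occurrences-< k<xs)

S-k<r : ∀ {k r} m → k < r → Sℤ k r m ≡ 0ℤ
S-k<r {k} {r} m k<r = total-zero (occurrences k) r m λ xs (r≤xs , _) →
  occurrences-< (All.map (≤-trans k<r) r≤xs)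

-- A nonempty list of parts at least `r` has sum at least `r`, so only the empty partition can
-- occur.
S-m<r : ∀ k {r m} → m < r → Sℤ k r m ≡ 0ℤ
S-m<r k {r} {m} m<r = total-zero (occurrences k) r m λ where
  []       _                     → refl
  (x ∷ xs) (r≤x ∷ _ , _ , refl) → ⊥-elim (m+n≮m x (sum xs) (≤-trans m<r r≤x))

total-cong : ∀ {f g} r → f ≗ g → total f r ≗ total g r
total-cong r eq m = cong (+_ ∘ sum) (map-cong eq (partitions≥ r m))

S-recurrence-≢ : ∀ {k r} m → 1 ≤ r → k ≢ r →
  Sℤ k r m ≡ Sℤ k (suc r) m ℤ.+ shift r (Sℤ k r) m
S-recurrence-≢ {k} {r} m 1≤r k≢r = trans (total-recurrence (occurrences k) m 1≤r)
  (cong (ℤ._+_ (Sℤ k (suc r) m)) (shift-≗ r (total-cong r λ xs → occurrences-≢ xs k≢r) m))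

S-recurrence-≡ : ∀ {r} m → 1 ≤ r →
  Sℤ r r m ≡ Sℤ r (suc r) m ℤ.+ shift r (λ i → count r i ℤ.+ Sℤ r r i) m
S-recurrence-≡ {r} m 1≤r = trans (total-recurrence (occurrences r) m 1≤r)
  (cong (ℤ._+_ (Sℤ r (suc r) m)) (shift-≗ r (λ i →
    trans (total-cong r (occurrences-≡ r) i) (total-+ (const 1) (occurrences r) r i)) m))

-- Deleting one part k from a partition containing it, read off the recurrences in r alone.
S-recurrence-k : ∀ i {k r} → 1 ≤ r → i + r ≡ k → ∀ m →
  Sℤ k r m ≡ shift k (λ j → count r j ℤ.+ Sℤ k r j) m
S-recurrence-k zero    {r = r} 1≤r refl m = begin
  Sℤ r r m
    ≡⟨ S-recurrence-≡ m 1≤r ⟩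
  Sℤ r (suc r) m ℤ.+ shift r (λ j → count r j ℤ.+ Sℤ r r j) m
    ≡⟨ cong (ℤ._+ shift r (λ j → count r j ℤ.+ Sℤ r r j) m) (S-k<r m (n<1+n r)) ⟩
  0ℤ ℤ.+ shift r (λ j → count r j ℤ.+ Sℤ r r j) m
    ≡⟨ ℤ.+-identityˡ _ ⟩
  shift r (λ j → count r j ℤ.+ Sℤ r r j) m ∎
S-recurrence-k (suc i) {k} {r} 1≤r refl =
  -- Induction on `k - r`: both sides solve F = S_k^{r+1} + q^r F, the right one by the induction
  -- hypothesis at `suc r`.
  shift-recurrence-unique {h = Sℤ k (suc r)} 1≤r (λ m → S-recurrence-≢ m 1≤r k≢r) λ m → begin
    shift k (λ j → count r j ℤ.+ Sℤ k r j) m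
      ≡⟨ shift-≗ k (λ j → cong₂ ℤ._+_ (count-recurrence j 1≤r) (S-recurrence-≢ j 1≤r k≢r)) m ⟩
    shift k (λ j → (count (suc r) j ℤ.+ shift r (count r) j) ℤ.+ (Sℤ k (suc r) j ℤ.+ shift r (Sℤ k r) j)) m
      ≡⟨ shift-≗ k (λ j → trans (ℤ-interchange (count (suc r) j) (shift r (count r) j) (Sℤ k (suc r) j) (shift r (Sℤ k r) j))
           (cong (ℤ._+_ (count (suc r) j ℤ.+ Sℤ k (suc r) j)) (sym (shift-distrib-+ r (count r) (Sℤ k r) j)))) m ⟩
    shift k (λ j → (count (suc r) j ℤ.+ Sℤ k (suc r) j) ℤ.+ shift r (λ l → count r l ℤ.+ Sℤ k r l) j) m
      ≡⟨ shift-distrib-+ k _ _ m ⟩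
    shift k (λ j → count (suc r) j ℤ.+ Sℤ k (suc r) j) m ℤ.+ shift k (shift r (λ l → count r l ℤ.+ Sℤ k r l)) m
      ≡⟨ cong₂ ℤ._+_ (sym (S-recurrence-k i (m≤n⇒m≤1+n 1≤r) (+-suc i r) m)) (shift-comm k r _ m) ⟩
    Sℤ k (suc r) m ℤ.+ shift r (shift k (λ l → count r l ℤ.+ Sℤ k r l)) m ∎
  where
  k≢r : k ≢ r
  k≢r = >⇒≢ (s≤s (m≤n+m r i))

  ℤ-interchange : ∀ w x y z → (w ℤ.+ x) ℤ.+ (y ℤ.+ z) ≡ (w ℤ.+ y) ℤ.+ (x ℤ.+ z)
  ℤ-interchange = solve-∀

-- The Möbius function

𝟙 : ∀ {A : Set} → Dec A → ℤ
𝟙 A? = if does A? then 1ℤ else 0ℤ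

𝟙-yes : ∀ {A : Set} (A? : Dec A) → A → 𝟙 A? ≡ 1ℤ
𝟙-yes A? a = cong (if_then 1ℤ else 0ℤ) (dec-true A? a)

𝟙-no : ∀ {A : Set} (A? : Dec A) → ¬ A → 𝟙 A? ≡ 0ℤ
𝟙-no A? ¬a = cong (if_then 1ℤ else 0ℤ) (dec-false A? ¬a)

𝟙-cong : ∀ {A B : Set} (A? : Dec A) (B? : Dec B) → (A → B) → (B → A) → 𝟙 A? ≡ 𝟙 B?
𝟙-cong (yes a) B? to from = sym (𝟙-yes B? (to a))
𝟙-cong (no ¬a) B? to from = sym (𝟙-no B? (¬a ∘ from))

μ-square : ∀ m → PrimeSquareDivides m → μ m ≡ 0ℤ
μ-square zero      _  = refl
μ-square m@(suc _) sq =
  cong (λ b → if b then 0ℤ else -1ℤ ℤ.^ length (factors (factorise m)))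
       (dec-true (primeSquareDivides? m) sq)

-- Unique factorisation makes the number of prime factors independent of the chosen factorisation,
-- so `μ` can be computed from any explicit one.
μ-squarefree : ∀ m .{{_ : NonZero m}} → ¬ PrimeSquareDivides m → (f : PrimeFactorisation m) →
               μ m ≡ -1ℤ ℤ.^ length (factors f)
μ-squarefree m@(suc _) ¬sq f = begin
  μ m
    ≡⟨ cong (λ b → if b then 0ℤ else -1ℤ ℤ.^ length (factors (factorise m)))
            (dec-false (primeSquareDivides? m) ¬sq) ⟩
  -1ℤ ℤ.^ length (factors (factorise m))
    ≡⟨ cong (-1ℤ ℤ.^_) (↭-length (factorisationUnique (factorise m) f)) ⟩
  -1ℤ ℤ.^ length (factors f) ∎

prime∣prime⇒≡ : ∀ {s q} → Prime s → Prime q → s ∣ q → s ≡ q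
prime∣prime⇒≡ s-prime q-prime s∣q with prime⇒irreducible q-prime s∣q
... | inj₁ refl = ⊥-elim (¬prime[1] s-prime)
... | inj₂ s≡q  = s≡q

-- Euclid's lemma is applied twice, moving one factor `s` into `k` each time.
prime-square-∣-cancelˡ : ∀ {s q k} → Prime s → ¬ s ∣ q → s * s ∣ q * k → s * s ∣ k
prime-square-∣-cancelˡ {s} {q} {k} s-prime s∤q s²∣qk
  with euclidsLemma q k s-prime (∣-trans (m∣m*n s) s²∣qk)
... | inj₁ s∣q = ⊥-elim (s∤q s∣q)
... | inj₂ (divides-refl k′)
  with euclidsLemma q k′ s-prime
         (*-cancelʳ-∣ s {{prime⇒nonZero s-prime}} (subst (s * s ∣_) (sym (*-assoc q k′ s)) s²∣qk))
... | inj₁ s∣q  = ⊥-elim (s∤q s∣q)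
... | inj₂ s∣k′ = *-monoˡ-∣ s s∣k′

-- Prepending `q` to a factorisation of `k` flips the sign, and `q * k` is squarefree exactly when
-- `k` is.
μ-prime-* : ∀ {q} k → Prime q → ¬ q ∣ k → μ (q * k) ≡ ℤ.- μ k
μ-prime-* {q} zero      q-prime q∤k = ⊥-elim (q∤k (q ∣0))
μ-prime-* {q} k@(suc _) q-prime q∤k with primeSquareDivides? k
... | yes (s , s-prime , s²∣k) = trans
        (μ-square (q * k) (s , s-prime , ∣n⇒∣m*n q s²∣k))
        (cong ℤ.-_ (sym (μ-square k (s , s-prime , s²∣k))))
... | no ¬sq = begin
  μ (q * k)                                         ≡⟨ μ-squarefree (q * k) {{qk≢0}} ¬sq′ factorisation ⟩
  -1ℤ ℤ.* -1ℤ ℤ.^ length (factors (factorise k))    ≡⟨ ℤ.-1*i≡-i _ ⟩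
  ℤ.- (-1ℤ ℤ.^ length (factors (factorise k)))      ≡⟨ cong ℤ.-_ (μ-squarefree k ¬sq (factorise k)) ⟨
  ℤ.- μ k                                           ∎
  where
  qk≢0 : NonZero (q * k)
  qk≢0 = m*n≢0 q k {{prime⇒nonZero q-prime}}

  ¬sq′ : ¬ PrimeSquareDivides (q * k)
  ¬sq′ (s , s-prime , s²∣qk) with s ∣? q
  ... | no s∤q = ¬sq (s , s-prime , prime-square-∣-cancelˡ s-prime s∤q s²∣qk)
  -- Here `s` equals `q`, and cancelling one `q` from `q * q ∣ q * k` contradicts `q∤k`.
  ... | yes s∣q with refl ← prime∣prime⇒≡ s-prime q-prime s∣q =
    q∤k (*-cancelˡ-∣ q {{prime⇒nonZero q-prime}} s²∣qk)

  factorisation : PrimeFactorisation (q * k)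
  factorisation = record
    { factors         = q ∷ factors (factorise k)
    ; isFactorisation = cong (q *_) (isFactorisation (factorise k))
    ; factorsPrime    = q-prime ∷ factorsPrime (factorise k)
    }

prime-divisor : ∀ n → 2 ≤ n → ∃ λ q → Prime q × q ∣ n
prime-divisor n@(suc _) 2≤n with factorise n
... | record { factors = [] ; isFactorisation = n≡1 } = ⊥-elim (<⇒≢ 2≤n (sym n≡1))
... | record { factors = q ∷ qs ; isFactorisation = n≡ ; factorsPrime = q-prime ∷ _ } =
  q , q-prime , subst (q ∣_) (sym n≡) (m∣m*n (product qs))

-- A double sum over the pairs with `k ≡ q * j` is evaluated in both orders. The range of `j` can
-- stay at `N` because `g` vanishes from `N` on.
∑<-multiples : ∀ N q .{{_ : NonZero q}} (g : Seq) → (∀ k → N ≤ k → g k ≡ 0ℤ) →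
               ∑< N (λ k → 𝟙 (q ∣? k) ℤ.* g k) ≡ ∑< N (λ j → g (q * j))
∑<-multiples N q g g≡0 = begin
  ∑< N (λ k → 𝟙 (q ∣? k) ℤ.* g k)                  ≡⟨ ∑<-cong N (λ k k<N → sym (inner k k<N)) ⟩
  ∑< N (λ k → ∑< N (λ j → term j k))  ≡⟨ ∑-comm {N} {N} (λ k j → term (toℕ j) (toℕ k)) ⟩
  ∑< N (λ j → ∑< N (term j))  ≡⟨ ∑<-cong N (λ j _ → outer j) ⟩
  ∑< N (λ j → g (q * j))                           ∎
  where
  term : ℕ → Seq
  term j k = 𝟙 (k ≟ q * j) ℤ.* g k

  term-no : ∀ j k → k ≢ q * j → term j k ≡ 0ℤ
  term-no j k k≢qj = cong (ℤ._* g k) (𝟙-no (k ≟ q * j) k≢qj)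

  term-yes : ∀ j k → k ≡ q * j → term j k ≡ g k
  term-yes j k k≡qj = trans (cong (ℤ._* g k) (𝟙-yes (k ≟ q * j) k≡qj)) (ℤ.*-identityˡ (g k))

  inner : ∀ k → k < N → ∑< N (λ j → term j k) ≡ 𝟙 (q ∣? k) ℤ.* g k
  inner k k<N with q ∣? k
  ... | no q∤k = ∑<-zero N {λ j → term j k} λ j _ → term-no j k λ { refl → q∤k (m∣m*n j) }
  ... | yes (divides j refl) = begin
    ∑< N (λ i → term i (j * q))
      ≡⟨ ∑<-single N (λ i → term i (j * q)) (≤-<-trans (m≤m*n j q) k<N) (λ i i≢j → term-no i (j * q) λ jq≡qi →
           i≢j (sym (*-cancelˡ-≡ j i q (trans (*-comm q j) jq≡qi)))) ⟩
    term j (j * q)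
      ≡⟨ term-yes j (j * q) (*-comm j q) ⟩
    g (j * q)
      ≡⟨ ℤ.*-identityˡ _ ⟨
    1ℤ ℤ.* g (j * q) ∎

  outer : ∀ j → ∑< N (term j) ≡ g (q * j)
  outer j with q * j <? N
  ... | yes qj<N = trans (∑<-single N (term j) qj<N (term-no j)) (term-yes j (q * j) refl)
  ... | no qj≮N  = trans (∑<-zero N {term j} λ k k<N → term-no j k λ { refl → qj≮N k<N })
                         (sym (g≡0 (q * j) (≮⇒≥ qj≮N)))

-- The coefficients of q^k / (1 - q^k) for `k ≥ 1`. Index 0 is set apart because `k ∣ 0` always
-- holds, while only positive multiples count.
multiples : ℕ → Seq
multiples k zero    = 0ℤ
multiples k (suc d) = 𝟙 (k ∣? suc d)

-- A prime factor `q` of `d` splits the sum into the `k` prime to `q` and the `k` divisible by `q`.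
-- Reindexing the latter as `q * k` lets the two sums cancel term by term.
∑-μ-divisors : ∀ N d → 2 ≤ d → d < N → ∑< N (λ k → μ k ℤ.* 𝟙 (k ∣? d)) ≡ 0ℤ
∑-μ-divisors N d 2≤d d<N with q , q-prime , q∣d ← prime-divisor d 2≤d = begin
  ∑< N g
    ≡⟨ ∑<-cong N (λ k _ → split (𝟙 (q ∣? k)) (g k)) ⟩
  ∑< N (λ k → (1ℤ ℤ.- 𝟙 (q ∣? k)) ℤ.* g k ℤ.+ 𝟙 (q ∣? k) ℤ.* g k)
    ≡⟨ ∑<-distrib-+ N (λ k → (1ℤ ℤ.- 𝟙 (q ∣? k)) ℤ.* g k) (λ k → 𝟙 (q ∣? k) ℤ.* g k) ⟩
  ∑< N (λ k → (1ℤ ℤ.- 𝟙 (q ∣? k)) ℤ.* g k) ℤ.+ ∑< N (λ k → 𝟙 (q ∣? k) ℤ.* g k)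
    ≡⟨ cong (ℤ._+_ (∑< N (λ k → (1ℤ ℤ.- 𝟙 (q ∣? k)) ℤ.* g k))) (∑<-multiples N q {{prime⇒nonZero q-prime}} g g≡0) ⟩
  ∑< N (λ k → (1ℤ ℤ.- 𝟙 (q ∣? k)) ℤ.* g k) ℤ.+ ∑< N (λ k → g (q * k))
    ≡⟨ ∑<-distrib-+ N (λ k → (1ℤ ℤ.- 𝟙 (q ∣? k)) ℤ.* g k) (λ k → g (q * k)) ⟨
  ∑< N (λ k → (1ℤ ℤ.- 𝟙 (q ∣? k)) ℤ.* g k ℤ.+ g (q * k))
    ≡⟨ ∑<-zero N (λ k _ → cancel q q-prime q∣d k) ⟩
  0ℤ ∎
  where
  g : Seq
  g k = μ k ℤ.* 𝟙 (k ∣? d)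

  g≡0 : ∀ k → N ≤ k → g k ≡ 0ℤ
  g≡0 k N≤k = trans (cong (ℤ._*_ (μ k)) (𝟙-no (k ∣? d) (>⇒∤ {{d≢0}} (<-≤-trans d<N N≤k)))) (ℤ.*-zeroʳ (μ k))
    where d≢0 = ≢-nonZero (>⇒≢ (<-trans (s≤s z≤n) 2≤d))

  split : ∀ x y → y ≡ (1ℤ ℤ.- x) ℤ.* y ℤ.+ x ℤ.* y
  split = solve-∀

  -- Among the divisors of d, those prime to q and their q-multiples cancel in pairs.
  cancel : ∀ q → Prime q → q ∣ d → ∀ k → (1ℤ ℤ.- 𝟙 (q ∣? k)) ℤ.* g k ℤ.+ g (q * k) ≡ 0ℤ
  cancel q q-prime q∣d k with q ∣? k
  ... | yes q∣k = begin
    0ℤ ℤ.* g k ℤ.+ g (q * k)              ≡⟨ ℤ.+-identityˡ _ ⟩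
    μ (q * k) ℤ.* 𝟙 (q * k ∣? d)          ≡⟨ cong (ℤ._* 𝟙 (q * k ∣? d))
                                               (μ-square (q * k) (q , q-prime , *-monoʳ-∣ q q∣k)) ⟩
    0ℤ                                    ∎
  ... | no q∤k = begin
    1ℤ ℤ.* g k ℤ.+ μ (q * k) ℤ.* 𝟙 (q * k ∣? d)
      ≡⟨ cong (ℤ._+_ (1ℤ ℤ.* g k)) (cong₂ ℤ._*_ (μ-prime-* k q-prime q∤k)
           (𝟙-cong (q * k ∣? d) (k ∣? d) (∣-trans (n∣m*n q)) multiple)) ⟩
    1ℤ ℤ.* (μ k ℤ.* 𝟙 (k ∣? d)) ℤ.+ ℤ.- μ k ℤ.* 𝟙 (k ∣? d)
      ≡⟨ cancelled (μ k) (𝟙 (k ∣? d)) ⟩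
    0ℤ ∎
    where
    cancelled : ∀ x y → 1ℤ ℤ.* (x ℤ.* y) ℤ.+ ℤ.- x ℤ.* y ≡ 0ℤ
    cancelled = solve-∀

    multiple : k ∣ d → q * k ∣ d
    multiple (divides-refl e) with euclidsLemma e k q-prime q∣d
    ... | inj₁ q∣e = *-monoˡ-∣ k q∣e
    ... | inj₂ q∣k = ⊥-elim (q∤k q∣k)

-- Möbius inversion as an identity of sequences: `shift 1 δ` is the indicator of `d ≡ 1`, and at
-- `d ≡ 0` every term vanishes.
∑-μ-multiples : ∀ N d → d < N → ∑< N (λ k → μ k ℤ.* multiples k d) ≡ shift 1 δ d
∑-μ-multiples N zero d<N = ∑<-zero N λ k _ → ℤ.*-zeroʳ (μ k)
∑-μ-multiples N (suc zero) d<N = ∑<-single N _ d<N λ k k≢1 →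
  trans (cong (ℤ._*_ (μ k)) (𝟙-no (k ∣? 1) (k≢1 ∘ ∣1⇒≡1))) (ℤ.*-zeroʳ (μ k))
∑-μ-multiples N (suc (suc d)) d<N = ∑-μ-divisors N (suc (suc d)) (s≤s (s≤s z≤n)) d<N

-- The weighted sum over all parts

-- A positive multiple of `k` is either `k` itself or `k` plus a positive multiple, that is, M = q^k
-- (1 + M).
multiples-recurrence : ∀ {k} d → 1 ≤ k → multiples k d ≡ shift k (λ j → δ j ℤ.+ multiples k j) d
multiples-recurrence {k} d 1≤k with d <? k
... | yes d<k = trans (multiples-< d d<k) (sym (shift-< k _ d d<k))
  where
  multiples-< : ∀ d → d < k → multiples k d ≡ 0ℤ
  multiples-< zero    _   = refl
  multiples-< (suc d) d<k = 𝟙-no (k ∣? suc d) (>⇒∤ d<k)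
... | no d≮k with j , refl ← m≤n⇒∃[o]m+o≡n (≮⇒≥ d≮k) =
  trans (multiples-+ 1≤k j) (sym (shift-+ k (λ i → δ i ℤ.+ multiples k i) j))
  where
  multiples-+ : ∀ {k} → 1 ≤ k → ∀ j → multiples k (k + j) ≡ δ j ℤ.+ multiples k j
  multiples-+ {k@(suc _)} _ zero    = 𝟙-yes (k ∣? k + 0) (∣-reflexive (sym (+-identityʳ k)))
  multiples-+ {k@(suc _)} _ (suc j) = trans
    (𝟙-cong (k ∣? k + suc j) (k ∣? suc j) (λ k∣ → ∣m+n∣m⇒∣n k∣ ∣-refl) (∣m∣n⇒∣m+n ∣-refl))
    (sym (ℤ.+-identityˡ _))

-- Both sides solve F = q^k P + q^k F.
S-conv : ∀ {k} → 1 ≤ k → Sℤ k 1 ≗ conv (multiples k) P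
S-conv {k@(suc i)} 1≤k = shift-recurrence-unique {h = shift k P} 1≤k
  (λ m → begin
    Sℤ k 1 m                                       ≡⟨ S-recurrence-k i (s≤s z≤n) (+-comm i 1) m ⟩
    shift k (λ j → count 1 j ℤ.+ Sℤ k 1 j) m       ≡⟨ shift-≗ k (λ j → cong (ℤ._+ Sℤ k 1 j) (count-1 j)) m ⟩
    shift k (λ j → P j ℤ.+ Sℤ k 1 j) m             ≡⟨ shift-distrib-+ k P (Sℤ k 1) m ⟩
    shift k P m ℤ.+ shift k (Sℤ k 1) m             ∎)
  (λ m → begin
    conv (multiples k) P m
      ≡⟨ conv-congˡ P (λ d → multiples-recurrence d 1≤k) m ⟩
    conv (shift k (λ j → δ j ℤ.+ multiples k j)) P m
      ≡⟨ conv-shift k _ P m ⟩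
    shift k (conv (λ j → δ j ℤ.+ multiples k j) P) m
      ≡⟨ shift-≗ k (λ n → trans (conv-distrib-+ δ (multiples k) P n) (cong (ℤ._+ conv (multiples k) P n) (conv-identityˡ P n))) m ⟩
    shift k (λ n → P n ℤ.+ conv (multiples k) P n) m
      ≡⟨ shift-distrib-+ k P (conv (multiples k) P) m ⟩
    shift k P m ℤ.+ shift k (conv (multiples k) P) m ∎)

-- The sum of the theorem over all k < N; it is independent of N once m < N.
weighted : ℕ → ℕ → Seq
weighted N r m = ∑< N (λ k → Sℤ k r m ℤ.* μ k)

-- Factoring `P` out of each S_k^1 leaves the Möbius sum of the `multiples k`, which equals q. The
-- bound `m < N` covers every degree `d ≤ m` entering the product.
weighted-1 : ∀ N m → m < N → weighted N 1 m ≡ shift 1 P m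
weighted-1 N m m<N = begin
  ∑< N (λ k → Sℤ k 1 m ℤ.* μ k)
    ≡⟨ ∑<-cong N (λ k _ → term k) ⟩
  ∑< N (λ k → conv (λ d → μ k ℤ.* multiples k d) P m)
    ≡⟨ conv-∑< N (λ k d → μ k ℤ.* multiples k d) P m ⟨
  conv (λ d → ∑< N (λ k → μ k ℤ.* multiples k d)) P m
    ≡⟨ conv-congˡ-≤ P m (λ d d≤m → ∑-μ-multiples N d (≤-<-trans d≤m m<N)) ⟩
  conv (shift 1 δ) P m
    ≡⟨ conv-shift 1 δ P m ⟩
  shift 1 (conv δ P) m
    ≡⟨ shift-≗ 1 (conv-identityˡ P) m ⟩
  shift 1 P m ∎
  where
  term : ∀ k → Sℤ k 1 m ℤ.* μ k ≡ conv (λ d → μ k ℤ.* multiples k d) P m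
  -- `S-conv` needs `1 ≤ k`; at 0 both sides vanish because `μ 0` is 0.
  term zero = trans (ℤ.*-zeroʳ (Sℤ 0 1 m)) (sym (conv-*ˡ 0ℤ (multiples 0) P m))
  term k@(suc _) = begin
    Sℤ k 1 m ℤ.* μ k                         ≡⟨ ℤ.*-comm (Sℤ k 1 m) (μ k) ⟩
    μ k ℤ.* Sℤ k 1 m                         ≡⟨ cong (ℤ._*_ (μ k)) (S-conv (s≤s z≤n) m) ⟩
    μ k ℤ.* conv (multiples k) P m           ≡⟨ conv-*ˡ (μ k) (multiples k) P m ⟨
    conv (λ d → μ k ℤ.* multiples k d) P m   ∎

-- The indicator merges the cases `k ≡ r` and `k ≢ r` into one formula that can be summed over `k`.
S-recurrence : ∀ k {r} m → 1 ≤ r →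
  Sℤ k r m ≡ Sℤ k (suc r) m ℤ.+ shift r (λ i → Sℤ k r i ℤ.+ 𝟙 (k ≟ r) ℤ.* count r i) m
-- The decision is passed as an argument so that the indicator computes in each case.
S-recurrence k {r} m 1≤r = by-cases (k ≟ r)
  where
  by-cases : (k≟r : Dec (k ≡ r)) →
    Sℤ k r m ≡ Sℤ k (suc r) m ℤ.+ shift r (λ i → Sℤ k r i ℤ.+ 𝟙 k≟r ℤ.* count r i) m
  by-cases (yes refl) = trans (S-recurrence-≡ m 1≤r) (cong (ℤ._+_ (Sℤ k (suc r) m))
    (shift-≗ r (λ i → trans (ℤ.+-comm (count r i) (Sℤ k r i)) (cong (ℤ._+_ (Sℤ k r i)) (sym (ℤ.*-identityˡ (count r i))))) m))
  by-cases (no k≢r)   = trans (S-recurrence-≢ m 1≤r k≢r) (cong (ℤ._+_ (Sℤ k (suc r) m))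
    (shift-≗ r (λ i → sym (ℤ.+-identityʳ (Sℤ k r i))) m))

-- Because `r < N`, the index `k ≡ r` occurs in the sum, and the indicator contributes `μ r` times
-- C_r there and nothing elsewhere.
weighted-recurrence : ∀ {N r} m → 1 ≤ r → r < N →
  weighted N r m ≡ weighted N (suc r) m ℤ.+ shift r (λ i → weighted N r i ℤ.+ μ r ℤ.* count r i) m
weighted-recurrence {N} {r} m 1≤r r<N = begin
  ∑< N (λ k → Sℤ k r m ℤ.* μ k)
    ≡⟨ ∑<-cong N (λ k _ → term k) ⟩
  ∑< N (λ k → Sℤ k (suc r) m ℤ.* μ k ℤ.+ shift r (λ i → Sℤ k r i ℤ.* μ k ℤ.+ extra i k) m)
    ≡⟨ ∑<-distrib-+ N (λ k → Sℤ k (suc r) m ℤ.* μ k) (λ k → shift r (λ i → Sℤ k r i ℤ.* μ k ℤ.+ extra i k) m) ⟩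
  weighted N (suc r) m ℤ.+ ∑< N (λ k → shift r (λ i → Sℤ k r i ℤ.* μ k ℤ.+ extra i k) m)
    ≡⟨ cong (ℤ._+_ (weighted N (suc r) m)) (shift-∑< N r (λ k i → Sℤ k r i ℤ.* μ k ℤ.+ extra i k) m) ⟨
  weighted N (suc r) m ℤ.+ shift r (λ i → ∑< N (λ k → Sℤ k r i ℤ.* μ k ℤ.+ extra i k)) m
    ≡⟨ cong (ℤ._+_ (weighted N (suc r) m)) (shift-≗ r sum-extra m) ⟩
  weighted N (suc r) m ℤ.+ shift r (λ i → weighted N r i ℤ.+ μ r ℤ.* count r i) m ∎
  where
  extra : ℕ → Seq
  extra i k = 𝟙 (k ≟ r) ℤ.* (μ k ℤ.* count r i)

  extra-≡ : ∀ i → extra i r ≡ μ r ℤ.* count r i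
  extra-≡ i = trans (cong (ℤ._* (μ r ℤ.* count r i)) (𝟙-yes (r ≟ r) refl)) (ℤ.*-identityˡ _)

  extra-≢ : ∀ i k → k ≢ r → extra i k ≡ 0ℤ
  extra-≢ i k k≢r = cong (ℤ._* (μ k ℤ.* count r i)) (𝟙-no (k ≟ r) k≢r)

  sum-extra : ∀ i → ∑< N (λ k → Sℤ k r i ℤ.* μ k ℤ.+ extra i k) ≡ weighted N r i ℤ.+ μ r ℤ.* count r i
  sum-extra i = trans
    (∑<-distrib-+ N (λ k → Sℤ k r i ℤ.* μ k) (extra i))
    (cong (ℤ._+_ (weighted N r i)) (trans (∑<-single N (extra i) r<N (extra-≢ i)) (extra-≡ i)))

  distribute : ∀ s c m e → m ℤ.* (s ℤ.+ e ℤ.* c) ≡ s ℤ.* m ℤ.+ e ℤ.* (m ℤ.* c)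
  distribute = solve-∀

  term : ∀ k → Sℤ k r m ℤ.* μ k ≡
               Sℤ k (suc r) m ℤ.* μ k ℤ.+ shift r (λ i → Sℤ k r i ℤ.* μ k ℤ.+ extra i k) m
  term k = begin
    Sℤ k r m ℤ.* μ k
      ≡⟨ cong (ℤ._* μ k) (S-recurrence k m 1≤r) ⟩
    (Sℤ k (suc r) m ℤ.+ shift r f m) ℤ.* μ k
      ≡⟨ ℤ.*-distribʳ-+ (μ k) (Sℤ k (suc r) m) (shift r f m) ⟩
    Sℤ k (suc r) m ℤ.* μ k ℤ.+ shift r f m ℤ.* μ k
      ≡⟨ cong (ℤ._+_ (Sℤ k (suc r) m ℤ.* μ k)) (ℤ.*-comm (shift r f m) (μ k)) ⟩
    Sℤ k (suc r) m ℤ.* μ k ℤ.+ μ k ℤ.* shift r f m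
      ≡⟨ cong (ℤ._+_ (Sℤ k (suc r) m ℤ.* μ k)) (shift-*ˡ (μ k) r f m) ⟨
    Sℤ k (suc r) m ℤ.* μ k ℤ.+ shift r (λ i → μ k ℤ.* f i) m
      ≡⟨ cong (ℤ._+_ (Sℤ k (suc r) m ℤ.* μ k)) (shift-≗ r (λ i → distribute (Sℤ k r i) (count r i) (μ k) (𝟙 (k ≟ r))) m) ⟩
    Sℤ k (suc r) m ℤ.* μ k ℤ.+ shift r (λ i → Sℤ k r i ℤ.* μ k ℤ.+ extra i k) m ∎
    where
    f : Seq
    f i = Sℤ k r i ℤ.+ 𝟙 (k ≟ r) ℤ.* count r i

weighted-< : ∀ N {r m} → m < r → weighted N r m ≡ 0ℤ
weighted-< N {r} {m} m<r = ∑<-zero N λ k _ → cong (ℤ._* μ k) (S-m<r k m<r)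

-- The coefficient sequences a and b

b-1 : b 1 ≗ δ
b-1 zero    = refl
b-1 (suc _) = refl

a-1 : a 1 ≗ δ
a-1 zero    = refl
a-1 (suc _) = refl

b-suc : ∀ {r} → 1 ≤ r → ∀ j → b (suc r) j ≡ b r j ℤ.- shift r (b r) j
b-suc {r@(suc _)} _ j = cong (ℤ._-_ (b r j)) (shift-if r (b r) j)

-- The recurrence for a (suc r), read one place earlier and extended to index 0.
a-pre : ℕ → Seq
a-pre r j = a r j ℤ.- μ r ℤ.* b r j ℤ.- shift r (a r) j

a-suc : ∀ {r} → 1 ≤ r → ∀ j → a (suc r) j ≡ a-pre r (suc j)
a-suc {r@(suc _)} _ j =
  cong (ℤ._-_ (a r (suc j) ℤ.- μ r ℤ.* b r (suc j))) (shift-if r (a r) (suc j))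

x≡y+z⇒y≡x-z : ∀ {x} y z → x ≡ y ℤ.+ z → y ≡ x ℤ.- z
x≡y+z⇒y≡x-z y z refl = cancel y z
  where
  cancel : ∀ y z → y ≡ y ℤ.+ z ℤ.- z
  cancel = solve-∀

-- C_{r+1} = (1 - q^r) C_r is the recurrence of `b`, and C_1 = P.
count-conv : ∀ {r} → 1 ≤ r → count r ≗ conv (b r) P
count-conv {1} _ m =
  trans (count-1 m) (sym (trans (conv-congˡ P b-1 m) (conv-identityˡ P m)))
count-conv {suc r@(suc _)} _ m = begin
  count (suc r) m
    ≡⟨ x≡y+z⇒y≡x-z (count (suc r) m) (shift r (count r) m) (count-recurrence m 1≤r) ⟩
  count r m ℤ.- shift r (count r) m
    ≡⟨ cong₂ ℤ._-_ (count-conv 1≤r m) (shift-≗ r (count-conv 1≤r) m) ⟩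
  conv (b r) P m ℤ.- shift r (conv (b r) P) m
    ≡⟨ cong (ℤ._-_ (conv (b r) P m)) (conv-shift r (b r) P m) ⟨
  conv (b r) P m ℤ.- conv (shift r (b r)) P m
    ≡⟨ conv-distrib-minus (b r) (shift r (b r)) P m ⟨
  conv (λ j → b r j ℤ.- shift r (b r) j) P m
    ≡⟨ conv-congˡ P (b-suc 1≤r) m ⟨
  conv (b (suc r)) P m ∎
  where
  1≤r : 1 ≤ r
  1≤r = s≤s z≤n

conv-a-pre : ∀ r m → conv (a-pre r) P m ≡
             conv (a r) P m ℤ.- μ r ℤ.* conv (b r) P m ℤ.- shift r (conv (a r) P) m
conv-a-pre r m = begin
  conv (a-pre r) P m
    ≡⟨ conv-distrib-minus (λ j → a r j ℤ.- μ r ℤ.* b r j) (shift r (a r)) P m ⟩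
  conv (λ j → a r j ℤ.- μ r ℤ.* b r j) P m ℤ.- conv (shift r (a r)) P m
    ≡⟨ cong₂ ℤ._-_ (conv-distrib-minus (a r) (λ j → μ r ℤ.* b r j) P m) (conv-shift r (a r) P m) ⟩
  conv (a r) P m ℤ.- conv (λ j → μ r ℤ.* b r j) P m ℤ.- shift r (conv (a r) P) m
    ≡⟨ cong (λ x → conv (a r) P m ℤ.- x ℤ.- shift r (conv (a r) P) m) (conv-*ˡ (μ r) (b r) P m) ⟩
  conv (a r) P m ℤ.- μ r ℤ.* conv (b r) P m ℤ.- shift r (conv (a r) P) m ∎

weighted-conv-suc : ∀ {N r} → 1 ≤ r → r < N →
  (∀ m → m < N → weighted N r m ≡ shift r (conv (a r) P) m) →
  ∀ m → m < N → weighted N (suc r) m ≡ shift (suc r) (conv (a (suc r)) P) m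
weighted-conv-suc {N} {r} 1≤r r<N hyp m m<N = begin
  weighted N (suc r) m
    ≡⟨ weighted-pre m m<N ⟩
  shift r (conv (a-pre r) P) m
    ≡⟨ shift-≗ r (λ i → trans (conv-congˡ P a-pre≗shift i) (conv-shift 1 (a (suc r)) P i)) m ⟩
  shift r (shift 1 (conv (a (suc r)) P)) m
    ≡⟨ shift-shift r 1 (conv (a (suc r)) P) m ⟩
  shift (r + 1) (conv (a (suc r)) P) m
    ≡⟨ cong (λ s → shift s (conv (a (suc r)) P) m) (+-comm r 1) ⟩
  shift (suc r) (conv (a (suc r)) P) m ∎
  where
  rearrange : ∀ x y z → x ℤ.- (z ℤ.+ y) ≡ x ℤ.- y ℤ.- z
  rearrange = solve-∀

  -- The recurrence is solved for T_{r+1}, C_r = b_r P and T_r = q^r a_r P are substituted, and the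
  -- common factor q^r is pulled out.
  weighted-pre : ∀ m → m < N → weighted N (suc r) m ≡ shift r (conv (a-pre r) P) m
  weighted-pre m m<N = begin
    weighted N (suc r) m
      ≡⟨ x≡y+z⇒y≡x-z (weighted N (suc r) m) _ (weighted-recurrence m 1≤r r<N) ⟩
    weighted N r m ℤ.- shift r (λ i → weighted N r i ℤ.+ μ r ℤ.* count r i) m
      -- `hyp` holds only below `N`, so the shifted part is compared just at the `i` with
      -- `r + i ≡ m`.
      ≡⟨ cong₂ ℤ._-_ (hyp m m<N) (shift-cong r m λ i r+i≡m →
           cong₂ ℤ._+_ (hyp i (≤-<-trans (subst (i ≤_) r+i≡m (m≤n+m i r)) m<N))
                       (cong (ℤ._*_ (μ r)) (count-conv 1≤r i))) ⟩
    shift r (conv (a r) P) m ℤ.- shift r (λ i → shift r (conv (a r) P) i ℤ.+ μ r ℤ.* conv (b r) P i) m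
      ≡⟨ shift-distrib-minus r (conv (a r) P) (λ i → shift r (conv (a r) P) i ℤ.+ μ r ℤ.* conv (b r) P i) m ⟨
    shift r (λ i → conv (a r) P i ℤ.- (shift r (conv (a r) P) i ℤ.+ μ r ℤ.* conv (b r) P i)) m
      ≡⟨ shift-≗ r (λ i → trans (rearrange (conv (a r) P i) (μ r ℤ.* conv (b r) P i) (shift r (conv (a r) P) i))
                                (sym (conv-a-pre r i))) m ⟩
    shift r (conv (a-pre r) P) m ∎

  -- Compare `weighted-pre` in degree `r`: the left side vanishes because `r < suc r`, and the right
  -- side is `a-pre r 0` times `P 0`, which is 1.
  a-pre-0 : a-pre r 0 ≡ 0ℤ
  a-pre-0 = begin
    a-pre r 0                           ≡⟨ ℤ.*-identityʳ _ ⟨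
    a-pre r 0 ℤ.* P 0                   ≡⟨ ℤ.+-identityʳ _ ⟨
    conv (a-pre r) P 0                  ≡⟨ shift-+ r (conv (a-pre r) P) 0 ⟨
    shift r (conv (a-pre r) P) (r + 0)  ≡⟨ cong (shift r (conv (a-pre r) P)) (+-identityʳ r) ⟩
    shift r (conv (a-pre r) P) r        ≡⟨ weighted-pre r r<N ⟨
    weighted N (suc r) r                ≡⟨ weighted-< N (n<1+n r) ⟩
    0ℤ                                  ∎

  a-pre≗shift : a-pre r ≗ shift 1 (a (suc r))
  a-pre≗shift zero    = a-pre-0
  a-pre≗shift (suc j) = sym (a-suc 1≤r j)

weighted-conv : ∀ {N r} → 1 ≤ r → r < N → ∀ m → m < N → weighted N r m ≡ shift r (conv (a r) P) m
weighted-conv {N} {1} _ _ m m<N = trans (weighted-1 N m m<N)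
  (sym (shift-≗ 1 (λ i → trans (conv-congˡ P a-1 i) (conv-identityˡ P i)) m))
weighted-conv {N} {suc r@(suc _)} _ 1+r<N = weighted-conv-suc (s≤s z≤n) r<N (weighted-conv (s≤s z≤n) r<N)
  where
  r<N : r < N
  r<N = <-trans (n<1+n r) 1+r<N

theorem1p3 : ∀ (n r : ℕ) → 1 ≤ r →
    (∑[ k from r to n + r ] (+ S r (n + r) k ℤ.* μ k))
    ≡∑[ j ≥0] (a r j ℤ.* + p (+ n ℤ.- + j))
-- Beyond `j ≡ n` the argument of `p` is negative, so `suc n` terms carry the whole sum.
theorem1p3 n r 1≤r = suc n , vanishing , (begin
  ∑< (suc n) (λ j → a r j ℤ.* + p (+ n ℤ.- + j))
    ≡⟨ ∑<-cong (suc n) (λ { j (s≤s j≤n) → cong (λ i → a r j ℤ.* + p i) (trans (ℤ.m-n≡m⊖n n j) (ℤ.⊖-≥ j≤n)) }) ⟩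
  conv (a r) P n
    ≡⟨ shift-+ r (conv (a r) P) n ⟨
  shift r (conv (a r) P) (r + n)
    ≡⟨ cong (shift r (conv (a r) P)) (+-comm r n) ⟩
  shift r (conv (a r) P) (n + r)
    ≡⟨ weighted-conv 1≤r (s≤s (m≤n+m r n)) (n + r) (n<1+n (n + r)) ⟨
  -- With `N` equal to `suc (n + r)` the index runs from 0 to `n + r`; the terms with `k < r`
  -- vanish, leaving the required interval.
  weighted (suc (n + r)) r (n + r)
    ≡⟨ cong (λ N → weighted N r (n + r)) (m+[n∸m]≡n (m≤n⇒m≤1+n (m≤n+m r n))) ⟨
  weighted (r + (suc (n + r) ∸ r)) r (n + r)
    ≡⟨ ∑<-drop r (suc (n + r) ∸ r) (λ k → Sℤ k r (n + r) ℤ.* μ k) (λ k k<r → cong (ℤ._* μ k) (S-k<r (n + r) k<r)) ⟩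
  (∑[ k from r to n + r ] (+ S r (n + r) k ℤ.* μ k)) ∎)
  where
  vanishing : ∀ j → suc n ≤ j → a r j ℤ.* + p (+ n ℤ.- + j) ≡ 0ℤ
  -- Writing `j` as `suc (n + i)` turns the argument of `p` into an explicit negative integer, where
  -- `p` is 0 by definition.
  vanishing j n<j with i , refl ← m≤n⇒∃[o]m+o≡n n<j = begin
    a r j ℤ.* + p (+ n ℤ.- + j)  ≡⟨ cong (λ x → a r j ℤ.* + p x) n-j ⟩
    a r j ℤ.* 0ℤ                 ≡⟨ ℤ.*-zeroʳ (a r j) ⟩
    0ℤ                           ∎
    where
    n-j : + n ℤ.- + suc (n + i) ≡ ℤ.- + suc i
    n-j = begin
      + n ℤ.- + suc (n + i)     ≡⟨ ℤ.m-n≡m⊖n n (suc (n + i)) ⟩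
      n ℤ.⊖ suc (n + i)         ≡⟨ ℤ.⊖-< n<j ⟩
      ℤ.- + (suc (n + i) ∸ n)   ≡⟨ cong (λ k → ℤ.- + (k ∸ n)) (+-suc n i) ⟨
      ℤ.- + (n + suc i ∸ n)     ≡⟨ cong (λ k → ℤ.- + k) (m+n∸m≡n n (suc i)) ⟩
      ℤ.- + suc i               ∎
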